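{- The complete bipartite graph $K_{3,3}$ and the triangular prism (two disjoint triangles $a_1a_2a_3$ and $b_1b_2b_3$ together with the edges $a_ib_i$, $i=1,2,3$) are 3-balanced, so that all connected cubic graphs on 6 vertices are 3-balanced.
   Context: A graph is 3-balanced if it admits a vertex coloring $\ell:V\to\mathbb{Z}_3$ such that every vertex has, in its open neighborhood, the same number of vertices of each of the three colors. -}

module Defs where

open import Data.Nat using (ℕ; _+_; _<ᵇ_; _≡ᵇ_)
open import Data.Bool using (Bool; true; false; T; _∧_; _∨_; not; _xor_)
open import Data.Fin using (Fin; toℕ; _≟_; zero; suc)
open import Data.List using (List; length; filter)
open import Data.Product using (Σ; _×_)
open import Relation.Binary.PropositionalEquality using (_≡_; refl)
open import Relation.Nullary.Decidable using (T?; _×-dec_)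
open import Data.List using (allFin) public

record Graph (n : ℕ) : Set where
  field
    adj   : Fin n → Fin n → Bool
    sym   : ∀ u v → adj u v ≡ adj v u
    irrefl : ∀ v → adj v v ≡ false
open Graph public

degree : ∀ {n} → Graph n → Fin n → ℕ
degree G v = length (filter (λ w → T? (adj G v w)) (allFin _))

nbrCount : ∀ {n} → Graph n → (Fin n → Fin 3) → Fin n → Fin 3 → ℕ
nbrCount G ℓ v c = length (filter (λ w → T? (adj G v w) ×-dec (ℓ w ≟ c)) (allFin _))

ThreeBalanced : ∀ {n} → Graph n → Set
ThreeBalanced G = Σ (_ → Fin 3) λ ℓ → ∀ v →
  (nbrCount G ℓ v zero ≡ nbrCount G ℓ v (suc zero))
  × (nbrCount G ℓ v (suc zero) ≡ nbrCount G ℓ v (suc (suc zero)))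

Cubic : ∀ {n} → Graph n → Set
Cubic G = ∀ v → degree G v ≡ 3

data Reach {n} (G : Graph n) : Fin n → Fin n → Set where
  here : ∀ {v} → Reach G v v
  step : ∀ {u v w} → T (adj G u v) → Reach G v w → Reach G u w

Connected : ∀ {n} → Graph n → Set
Connected G = ∀ u v → Reach G u v

k33adj : Fin 6 → Fin 6 → Bool
k33adj u v = (toℕ u <ᵇ 3) xor (toℕ v <ᵇ 3)

-- prism: a_i = i, b_i = i+3 (i = 0,1,2); triangles on each side plus a_i b_i
prismAdj : Fin 6 → Fin 6 → Bool
prismAdj u v =
  (((toℕ u <ᵇ 3) ≡ᵇB (toℕ v <ᵇ 3)) ∧ not (toℕ u ≡ᵇ toℕ v))
  ∨ ((toℕ u + 3) ≡ᵇ toℕ v) ∨ ((toℕ v + 3) ≡ᵇ toℕ u)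
  where
  _≡ᵇB_ : Bool → Bool → Bool
  a ≡ᵇB b = not (a xor b)

K33 : Graph 6
K33 = record { adj = k33adj ; sym = s ; irrefl = i }
  where
  s : ∀ u v → k33adj u v ≡ k33adj v u
  s (zero) (zero) = refl
  s (zero) (suc (zero)) = refl
  s (zero) (suc (suc (zero))) = refl
  s (zero) (suc (suc (suc (zero)))) = refl
  s (zero) (suc (suc (suc (suc (zero))))) = refl
  s (zero) (suc (suc (suc (suc (suc (zero)))))) = refl
  s (suc (zero)) (zero) = refl
  s (suc (zero)) (suc (zero)) = refl
  s (suc (zero)) (suc (suc (zero))) = refl
  s (suc (zero)) (suc (suc (suc (zero)))) = refl
  s (suc (zero)) (suc (suc (suc (suc (zero))))) = refl
  s (suc (zero)) (suc (suc (suc (suc (suc (zero)))))) = refl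
  s (suc (suc (zero))) (zero) = refl
  s (suc (suc (zero))) (suc (zero)) = refl
  s (suc (suc (zero))) (suc (suc (zero))) = refl
  s (suc (suc (zero))) (suc (suc (suc (zero)))) = refl
  s (suc (suc (zero))) (suc (suc (suc (suc (zero))))) = refl
  s (suc (suc (zero))) (suc (suc (suc (suc (suc (zero)))))) = refl
  s (suc (suc (suc (zero)))) (zero) = refl
  s (suc (suc (suc (zero)))) (suc (zero)) = refl
  s (suc (suc (suc (zero)))) (suc (suc (zero))) = refl
  s (suc (suc (suc (zero)))) (suc (suc (suc (zero)))) = refl
  s (suc (suc (suc (zero)))) (suc (suc (suc (suc (zero))))) = refl
  s (suc (suc (suc (zero)))) (suc (suc (suc (suc (suc (zero)))))) = refl
  s (suc (suc (suc (suc (zero))))) (zero) = refl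
  s (suc (suc (suc (suc (zero))))) (suc (zero)) = refl
  s (suc (suc (suc (suc (zero))))) (suc (suc (zero))) = refl
  s (suc (suc (suc (suc (zero))))) (suc (suc (suc (zero)))) = refl
  s (suc (suc (suc (suc (zero))))) (suc (suc (suc (suc (zero))))) = refl
  s (suc (suc (suc (suc (zero))))) (suc (suc (suc (suc (suc (zero)))))) = refl
  s (suc (suc (suc (suc (suc (zero)))))) (zero) = refl
  s (suc (suc (suc (suc (suc (zero)))))) (suc (zero)) = refl
  s (suc (suc (suc (suc (suc (zero)))))) (suc (suc (zero))) = refl
  s (suc (suc (suc (suc (suc (zero)))))) (suc (suc (suc (zero)))) = refl
  s (suc (suc (suc (suc (suc (zero)))))) (suc (suc (suc (suc (zero))))) = refl
  s (suc (suc (suc (suc (suc (zero)))))) (suc (suc (suc (suc (suc (zero)))))) = refl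
  i : ∀ v → k33adj v v ≡ false
  i (zero) = refl
  i (suc (zero)) = refl
  i (suc (suc (zero))) = refl
  i (suc (suc (suc (zero)))) = refl
  i (suc (suc (suc (suc (zero))))) = refl
  i (suc (suc (suc (suc (suc (zero)))))) = refl

Prism : Graph 6
Prism = record { adj = prismAdj ; sym = s ; irrefl = i }
  where
  s : ∀ u v → prismAdj u v ≡ prismAdj v u
  s (zero) (zero) = refl
  s (zero) (suc (zero)) = refl
  s (zero) (suc (suc (zero))) = refl
  s (zero) (suc (suc (suc (zero)))) = refl
  s (zero) (suc (suc (suc (suc (zero))))) = refl
  s (zero) (suc (suc (suc (suc (suc (zero)))))) = refl
  s (suc (zero)) (zero) = refl
  s (suc (zero)) (suc (zero)) = refl
  s (suc (zero)) (suc (suc (zero))) = refl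
  s (suc (zero)) (suc (suc (suc (zero)))) = refl
  s (suc (zero)) (suc (suc (suc (suc (zero))))) = refl
  s (suc (zero)) (suc (suc (suc (suc (suc (zero)))))) = refl
  s (suc (suc (zero))) (zero) = refl
  s (suc (suc (zero))) (suc (zero)) = refl
  s (suc (suc (zero))) (suc (suc (zero))) = refl
  s (suc (suc (zero))) (suc (suc (suc (zero)))) = refl
  s (suc (suc (zero))) (suc (suc (suc (suc (zero))))) = refl
  s (suc (suc (zero))) (suc (suc (suc (suc (suc (zero)))))) = refl
  s (suc (suc (suc (zero)))) (zero) = refl
  s (suc (suc (suc (zero)))) (suc (zero)) = refl
  s (suc (suc (suc (zero)))) (suc (suc (zero))) = refl
  s (suc (suc (suc (zero)))) (suc (suc (suc (zero)))) = refl
  s (suc (suc (suc (zero)))) (suc (suc (suc (suc (zero))))) = refl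
  s (suc (suc (suc (zero)))) (suc (suc (suc (suc (suc (zero)))))) = refl
  s (suc (suc (suc (suc (zero))))) (zero) = refl
  s (suc (suc (suc (suc (zero))))) (suc (zero)) = refl
  s (suc (suc (suc (suc (zero))))) (suc (suc (zero))) = refl
  s (suc (suc (suc (suc (zero))))) (suc (suc (suc (zero)))) = refl
  s (suc (suc (suc (suc (zero))))) (suc (suc (suc (suc (zero))))) = refl
  s (suc (suc (suc (suc (zero))))) (suc (suc (suc (suc (suc (zero)))))) = refl
  s (suc (suc (suc (suc (suc (zero)))))) (zero) = refl
  s (suc (suc (suc (suc (suc (zero)))))) (suc (zero)) = refl
  s (suc (suc (suc (suc (suc (zero)))))) (suc (suc (zero))) = refl
  s (suc (suc (suc (suc (suc (zero)))))) (suc (suc (suc (zero)))) = refl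
  s (suc (suc (suc (suc (suc (zero)))))) (suc (suc (suc (suc (zero))))) = refl
  s (suc (suc (suc (suc (suc (zero)))))) (suc (suc (suc (suc (suc (zero)))))) = refl
  i : ∀ v → prismAdj v v ≡ false
  i (zero) = refl
  i (suc (zero)) = refl
  i (suc (suc (zero))) = refl
  i (suc (suc (suc (zero)))) = refl
  i (suc (suc (suc (suc (zero))))) = refl
  i (suc (suc (suc (suc (suc (zero)))))) = refl

{-# OPTIONS --safe #-}
-- A graph is determined by the strict upper triangle of its adjacency matrix, so
-- the graphs on 6 vertices are the 2^15 triangles of bits, and for each of the
-- cubic ones a balanced colouring is found by search.
module Submission where

open import Defs
open import Data.Bool using (Bool; true; false; T)
open import Data.Fin using (Fin; zero; suc)
open import Data.Fin.Properties using (all?; any?)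
open import Data.List using (length)
open import Data.List.Properties using (filter-≐)
open import Data.Nat using (ℕ; zero; suc)
import Data.Nat as ℕ
open import Data.Product using (∃; _×_; _,_; proj₁; proj₂; map₁)
open import Data.Unit using (⊤; tt)
open import Data.Vec using (Vec; []; _∷_; lookup; tabulate)
open import Data.Vec.Properties using (lookup∘tabulate)
open import Function using (_∘_)
open import Relation.Binary.PropositionalEquality
  using (_≡_; refl; trans; cong; subst; subst₂) renaming (sym to ≡-sym)
open import Relation.Nullary.Decidable
  using (Dec; map′; _×-dec_; _→-dec_; from-yes)
open import Relation.Unary using (Decidable)

-- The vector holds the bits from vertex `zero` to the later vertices, the rest is the triangle of
-- the graph without `zero`. Unlike `Graph`, whose fields are functions and proofs, this is plain
-- data that can be enumerated by recursion on the size.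
Triangle : ℕ → Set
Triangle zero    = ⊤
Triangle (suc n) = Vec Bool n × Triangle n

entry : ∀ {n} → Triangle n → Fin n → Fin n → Bool
entry (r , t) zero    zero    = false
entry (r , t) zero    (suc j) = lookup r j
entry (r , t) (suc i) zero    = lookup r i
entry (r , t) (suc i) (suc j) = entry t i j

entry-sym : ∀ {n} (t : Triangle n) u v → entry t u v ≡ entry t v u
entry-sym (r , t) zero    zero    = refl
entry-sym (r , t) zero    (suc j) = refl
entry-sym (r , t) (suc i) zero    = refl
entry-sym (r , t) (suc i) (suc j) = entry-sym t i j

entry-irrefl : ∀ {n} (t : Triangle n) v → entry t v v ≡ false
entry-irrefl (r , t) zero    = refl
entry-irrefl (r , t) (suc i) = entry-irrefl t i

fromTriangle : ∀ {n} → Triangle n → Graph n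
fromTriangle t = record { adj = entry t ; sym = entry-sym t ; irrefl = entry-irrefl t }

deleteZero : ∀ {n} → Graph (suc n) → Graph n
deleteZero G = record
  { adj    = λ u v → adj G (suc u) (suc v)
  ; sym    = λ u v → sym G (suc u) (suc v)
  ; irrefl = λ v → irrefl G (suc v)
  }

toTriangle : ∀ {n} → Graph n → Triangle n
toTriangle {zero}  G = tt
toTriangle {suc n} G = tabulate (adj G zero ∘ suc) , toTriangle (deleteZero G)

-- Only the strict upper part is stored: irreflexivity of `G` recovers the diagonal and symmetry the
-- lower part.
entry-toTriangle : ∀ {n} (G : Graph n) u v → entry (toTriangle G) u v ≡ adj G u v
entry-toTriangle G zero    zero    = ≡-sym (irrefl G zero)
entry-toTriangle G zero    (suc j) = lookup∘tabulate _ j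
entry-toTriangle G (suc i) zero    = trans (lookup∘tabulate _ i) (sym G zero (suc i))
entry-toTriangle G (suc i) (suc j) = entry-toTriangle (deleteZero G) i j

module _ {n} (G H : Graph n) (G≗H : ∀ u v → adj G u v ≡ adj H u v) where

  -- Equivalent predicates filter the same list. Arguing with counts avoids an equality of graphs,
  -- which pointwise agreement does not give without function extensionality.
  degree-cong : ∀ v → degree G v ≡ degree H v
  degree-cong v = cong length (filter-≐ _ _
    ( (λ {w} → subst T (G≗H v w))
    , (λ {w} → subst T (≡-sym (G≗H v w)))) (allFin n))

  nbrCount-cong : ∀ ℓ v c → nbrCount G ℓ v c ≡ nbrCount H ℓ v c
  nbrCount-cong ℓ v c = cong length (filter-≐ _ _
    ( (λ {w} → map₁ (subst T (G≗H v w)))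
    , (λ {w} → map₁ (subst T (≡-sym (G≗H v w))))) (allFin n))

  cubic-resp : Cubic G → Cubic H
  cubic-resp cubic v = trans (≡-sym (degree-cong v)) (cubic v)

  threeBalanced-resp : ThreeBalanced G → ThreeBalanced H
  threeBalanced-resp (ℓ , balanced) = ℓ , λ v →
      subst₂ _≡_ (nbrCount-cong ℓ v _) (nbrCount-cong ℓ v _) (proj₁ (balanced v))
    , subst₂ _≡_ (nbrCount-cong ℓ v _) (nbrCount-cong ℓ v _) (proj₂ (balanced v))

allBool? : ∀ {P : Bool → Set} → Decidable P → Dec (∀ b → P b)
allBool? P? = map′ (λ { (f , t) false → f ; (f , t) true → t })
                   (λ p → p false , p true) (P? false ×-dec P? true)

allBits? : ∀ {n} {P : Vec Bool n → Set} → Decidable P → Dec (∀ bs → P bs)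
allBits? {zero}  P? = map′ (λ { p [] → p }) (λ p → p []) (P? [])
allBits? {suc n} P? = map′ (λ { p (b ∷ bs) → p b bs }) (λ p b bs → p (b ∷ bs))
  (allBool? λ b → allBits? λ bs → P? (b ∷ bs))

allTriangle? : ∀ {n} {P : Triangle n → Set} → Decidable P → Dec (∀ t → P t)
allTriangle? {zero}  P? = map′ (λ { p tt → p }) (λ p → p tt) (P? tt)
allTriangle? {suc n} P? = map′ (λ { p (r , t) → p r t }) (λ p r t → p (r , t))
  (allBits? λ r → allTriangle? λ t → P? (r , t))

-- Used to search for colourings as vectors: each vector is literally `[]` or `x ∷ xs`, whereas for
-- functions `P` would have to respect pointwise equality.
anyVec? : ∀ {k n} {P : Vec (Fin k) n → Set} → Decidable P → Dec (∃ P)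
anyVec? {n = zero}  P? = map′ ([] ,_) (λ { ([] , p) → p }) (P? [])
anyVec? {n = suc n} P? = map′ (λ { (x , xs , p) → x ∷ xs , p })
  (λ { (x ∷ xs , p) → x , xs , p }) (any? λ x → anyVec? λ xs → P? (x ∷ xs))

cubic? : ∀ {n} (G : Graph n) → Dec (Cubic G)
cubic? G = all? λ v → degree G v ℕ.≟ 3

Balances : ∀ {n} → Graph n → (Fin n → Fin 3) → Set
Balances G ℓ = ∀ v →
  (nbrCount G ℓ v zero ≡ nbrCount G ℓ v (suc zero))
  × (nbrCount G ℓ v (suc zero) ≡ nbrCount G ℓ v (suc (suc zero)))

balances? : ∀ {n} (G : Graph n) → Decidable (Balances G)
balances? G ℓ = all? λ v → (_ ℕ.≟ _) ×-dec (_ ℕ.≟ _)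

-- Holds by evaluation: `from-yes` type-checks because the decision reduces to yes. The search among
-- the 3^6 colourings matters only for triangles that pass `cubic?`.
cubicTriangle⇒balanced : (t : Triangle 6) → Cubic (fromTriangle t) →
  ∃ λ (c : Vec (Fin 3) 6) → Balances (fromTriangle t) (lookup c)
cubicTriangle⇒balanced = from-yes (allTriangle? {6} λ t →
  cubic? (fromTriangle t) →-dec anyVec? λ c → balances? (fromTriangle t) (lookup c))

-- Cubicity passes from `G` to the graph of its triangle, and the colouring found there passes back
-- unchanged, both along `entry-toTriangle`.
cubic₆⇒threeBalanced : (G : Graph 6) → Cubic G → ThreeBalanced G
cubic₆⇒threeBalanced G cubic =
  let t       = toTriangle G
      H       = fromTriangle t
      (c , b) = cubicTriangle⇒balanced t
                  (cubic-resp G H (λ u v → ≡-sym (entry-toTriangle G u v)) cubic)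
  in threeBalanced-resp H G (entry-toTriangle G) (lookup c , b)

theorem8p1 : ThreeBalanced K33 × ThreeBalanced Prism
    × ((G : Graph 6) → Connected G → Cubic G → ThreeBalanced G)
theorem8p1 =
    -- The two named graphs are instances of the general result, so no colouring is written out;
    -- their degrees are checked by evaluation.
    cubic₆⇒threeBalanced K33 (from-yes (cubic? K33))
  , cubic₆⇒threeBalanced Prism (from-yes (cubic? Prism))
  , λ G _ → cubic₆⇒threeBalanced G
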